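{- Let $I\subseteq\mathcal U$ be a two-sided ideal containing $I_{\mathrm C}$. Then the elements $h_1(\mathbf u),h_2(\mathbf u),\dots$ commute pairwise modulo $I$. Consequently, with $H(x)=\sum_{\ell\ge0}x^\ell h_\ell(\mathbf u)$, we have $H(x)H(y)\equiv H(y)H(x)\bmod I[[x,y]]$, where $x,y$ are formal variables commuting with each other and with $u_1,\dots,u_N$.
   Context: Fix a positive integer $N$ and let $\mathcal U=\mathbb Z\langle u_1,\dots,u_N\rangle$ be the free associative ring on noncommuting generators $u_1,\dots,u_N$. For $\ell>0$ let $h_\ell(\mathbf u)=\sum_{1\le i_1\le i_2\le\cdots\le i_\ell\le N}u_{i_1}u_{i_2}\cdots u_{i_\ell}$, $h_0(\mathbf u)=1$, $h_\ell(\mathbf u)=0$ for $\ell<0$. $I_{\mathrm C}$ denotes the two-sided ideal of $\mathcal U$ generated by the elements $u_b^2u_a+u_au_bu_a-u_bu_au_b-u_bu_a^2$ for $a<b$; $u_bu_cu_a+u_au_cu_b-u_bu_au_c-u_cu_au_b$ for $a<b<c$; and $u_cu_bu_cu_a+u_bu_cu_au_c-u_cu_bu_au_c-u_bu_c^2u_a$ for $a<b<c$ (all indices in $\{1,\dots,N\}$). -}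

module Defs where

open import Data.Nat using (ℕ; zero; suc; _∸_)
open import Data.Integer using (ℤ; 1ℤ; 0ℤ) renaming (_+_ to _+ℤ_; _*_ to _*ℤ_; -_ to -ℤ_)
open import Data.Fin using (Fin; _<_; _≤?_)
open import Data.Fin.Properties using (_≟_)
open import Data.List using (List; []; _∷_; _++_; map; concatMap; foldr; upTo; allFin; filterᵇ)
open import Data.List.Properties using (≡-dec)
open import Data.Product using (_×_; _,_)
open import Data.Bool using (Bool; true; false; _∧_; if_then_else_)
open import Relation.Nullary using (does)
open import Relation.Binary.PropositionalEquality using (_≡_)

-- The free associative ring ℤ⟨u₁,…,u_N⟩, with generators indexed by Fin N.
-- Words in the generators (monomials):
Word : ℕ → Set
Word N = List (Fin N)

-- Elements: finite formal ℤ-linear combinations of words (unnormalised),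
-- considered up to the setoid equality _≈_ below (equal coefficients).
U : ℕ → Set
U N = List (ℤ × Word N)

module _ {N : ℕ} where

  _≟w_ : (v w : Word N) → Bool
  v ≟w w = does (≡-dec _≟_ v w)

  coeff : U N → Word N → ℤ
  coeff [] w = 0ℤ
  coeff ((a , v) ∷ x) w = (if v ≟w w then a else 0ℤ) +ℤ coeff x w

  _≈_ : U N → U N → Set
  x ≈ y = ∀ w → coeff x w ≡ coeff y w

  𝟘 : U N
  𝟘 = []

  𝟙 : U N
  𝟙 = (1ℤ , []) ∷ []

  infixl 6 _+U_ _-U_
  infixl 7 _*U_

  _+U_ : U N → U N → U N
  x +U y = x ++ y

  -U_ : U N → U N
  -U_ = map (λ { (a , w) → (-ℤ a , w) })

  _-U_ : U N → U N → U N
  x -U y = x +U (-U y)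

  _*U_ : U N → U N → U N
  x *U y = concatMap (λ { (a , v) → map (λ { (b , w) → (a *ℤ b , v ++ w) }) y }) x

  mono : Word N → U N
  mono w = (1ℤ , w) ∷ []

  sumU : List (U N) → U N
  sumU = foldr _+U_ 𝟘

  record IsIdeal (P : U N → Set) : Set where
    field
      resp  : ∀ {x y} → x ≈ y → P x → P y
      zero∈ : P 𝟘
      +∈    : ∀ {x y} → P x → P y → P (x +U y)
      -∈    : ∀ {x} → P x → P (-U x)
      *ˡ∈   : ∀ r {x} → P x → P (r *U x)
      *ʳ∈   : ∀ {x} r → P x → P (x *U r)

  data GenC : U N → Set where
    g1 : ∀ a b → a < b →
         GenC (mono (b ∷ b ∷ a ∷ []) +U mono (a ∷ b ∷ a ∷ [])
               -U mono (b ∷ a ∷ b ∷ []) -U mono (b ∷ a ∷ a ∷ []))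
    g2 : ∀ a b c → a < b → b < c →
         GenC (mono (b ∷ c ∷ a ∷ []) +U mono (a ∷ c ∷ b ∷ [])
               -U mono (b ∷ a ∷ c ∷ []) -U mono (c ∷ a ∷ b ∷ []))
    g3 : ∀ a b c → a < b → b < c →
         GenC (mono (c ∷ b ∷ c ∷ a ∷ []) +U mono (b ∷ c ∷ a ∷ c ∷ [])
               -U mono (c ∷ b ∷ a ∷ c ∷ []) -U mono (b ∷ c ∷ c ∷ a ∷ []))

  data IC : U N → Set where
    gen  : ∀ {x} → GenC x → IC x
    resp : ∀ {x y} → x ≈ y → IC x → IC y
    zero∈ : IC 𝟘
    +∈   : ∀ {x y} → IC x → IC y → IC (x +U y)
    -∈   : ∀ {x} → IC x → IC (-U x)
    *ˡ∈  : ∀ r {x} → IC x → IC (r *U x)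
    *ʳ∈  : ∀ {x} r → IC x → IC (x *U r)

  allWords : ℕ → List (Word N)
  allWords zero = [] ∷ []
  allWords (suc ℓ) = concatMap (λ i → map (i ∷_) (allWords ℓ)) (allFin N)

  nondecreasing : Word N → Bool
  nondecreasing [] = true
  nondecreasing (x ∷ []) = true
  nondecreasing (x ∷ y ∷ w) = does (x ≤? y) ∧ nondecreasing (y ∷ w)

  -- h_ℓ(u) = Σ_{i₁ ≤ ⋯ ≤ i_ℓ} u_{i₁}⋯u_{i_ℓ}  (h₀ = 1 since the only word of length 0 is empty)
  h : ℕ → U N
  h ℓ = sumU (map mono (filterᵇ nondecreasing (allWords ℓ)))

  -- Formal power series in commuting variables x, y with coefficients in U N:
  -- S k l is the coefficient of x^k y^l.
  Series : Set
  Series = ℕ → ℕ → U N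

  _*S_ : Series → Series → Series
  (F *S G) k l = sumU (concatMap (λ i → map (λ j → F i j *U G (k ∸ i) (l ∸ j)) (upTo (suc l))) (upTo (suc k)))

  Hx : Series
  Hx k zero = h k
  Hx k (suc l) = 𝟘

  Hy : Series
  Hy zero l = h l
  Hy (suc k) l = 𝟘

  _≡S_mod_ : Series → Series → (U N → Set) → Set
  F ≡S G mod P = ∀ k l → P (F k l -U G k l)

module Submission where

-- The argument takes place in an arbitrary ring and a list x ∷ ys of its elements. Read with
-- x as the smallest variable, the generators of I_C say that y [y,x] = [y,x] x, y [z,x] = [z,x] y
-- and [z,y] [z,x] = 0 whenever y comes before z in ys. With C = Σ_{y ∈ ys} [y,x] they give the
-- exchange rule h_{m+1}(ys) x = x h_{m+1}(ys) + C h_m(x,ys); the key point is that after left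
-- multiplication by [z,x] the variables x and y may be swapped inside h(x,y,…). Expanding
-- h_{k+1}(x,ys) h_{l+1}(x,ys) through h_{k+1}(x,ys) = x h_k(x,ys) + h_{k+1}(ys) and the exchange
-- rule gives, up to the summand x² h_k h_l, an expression symmetric in k and l modulo commutations
-- already known by induction on k + l and on the number of variables. In ℤ⟨u⟩/I, h_ℓ(u) is the
-- complete homogeneous polynomial of the images of u_1, …, u_N (every word has the same
-- coefficient), and the coefficient of x^k y^l in H(x) H(y) is h_k h_l.

open import Level using (_⊔_)
open import Algebra.Bundles using (Ring)
open import Data.List using (List; []; _∷_; foldr)
open import Data.List.Relation.Unary.All as All using (All; []; _∷_)
open import Data.List.Relation.Unary.AllPairs using (AllPairs; []; _∷_)
open import Data.Nat using (ℕ; zero; suc)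
open import Data.Product using (_,_)

module CompleteHomogeneous {r ℓ} (R : Ring r ℓ) where

  open Ring R
  open import Algebra.Properties.Ring R
    using (x[y-z]≈xy-xz; [y-z]x≈yx-zx; +-cancelʳ; x∙y⁻¹≈ε⇒x≈y; x≈y⇒x∙y⁻¹≈ε; -‿anti-homo-+; -‿involutive)
  open import Algebra.Properties.CommutativeSemigroup +-commutativeSemigroup using (interchange)
  open import Algebra.Solver.CommutativeMonoid +-commutativeMonoid using (solve; _⊜_; _⊕_)
  open import Relation.Binary.Reasoning.Setoid setoid

  [_,_] : Carrier → Carrier → Carrier
  [ y , x ] = y * x - x * y

  complete : List Carrier → ℕ → Carrier
  complete xs       zero    = 1#
  complete []       (suc m) = 0#
  complete (x ∷ xs) (suc m) = x * complete (x ∷ xs) m + complete xs (suc m)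

  commutatorSum : Carrier → List Carrier → Carrier
  commutatorSum x = foldr (λ y s → [ y , x ] + s) 0#

  -- For a < b < c the generators of I_C are b[b,a] - [b,a]a, b[c,a] - [c,a]b and [c,b][c,a], up to
  -- rearrangement; LowestRelations x ys collects those whose smallest variable a is x.
  record LowestRelations (x : Carrier) (ys : List Carrier) : Set (r ⊔ ℓ) where
    field
      absorb     : All (λ y → y * [ y , x ] ≈ [ y , x ] * x) ys
      commute    : AllPairs (λ y z → y * [ z , x ] ≈ [ z , x ] * y) ys
      annihilate : AllPairs (λ y z → [ z , y ] * [ z , x ] ≈ 0#) ys

  data Relations : List Carrier → Set (r ⊔ ℓ) where
    []  : Relations []
    _∷_ : ∀ {x xs} → LowestRelations x xs → Relations xs → Relations (x ∷ xs)

  lowestRelations-tail : ∀ {x y zs} → LowestRelations x (y ∷ zs) → LowestRelations x zs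
  lowestRelations-tail record { absorb = _ ∷ ab ; commute = _ ∷ co ; annihilate = _ ∷ an } =
    record { absorb = ab ; commute = co ; annihilate = an }

  yx≈xy+[y,x] : ∀ y x → y * x ≈ x * y + [ y , x ]
  yx≈xy+[y,x] y x = begin
    y * x                   ≈⟨ +-identityˡ (y * x) ⟨
    0# + y * x              ≈⟨ +-congʳ (-‿inverseʳ (x * y)) ⟨
    (x * y - x * y) + y * x ≈⟨ solve 3 (λ p q r → (p ⊕ q) ⊕ r ⊜ p ⊕ (r ⊕ q)) refl (x * y) (- (x * y)) (y * x) ⟩
    x * y + [ y , x ]       ∎

  [a-b]c≈0⇒ac≈bc : ∀ {a b c} → (a - b) * c ≈ 0# → a * c ≈ b * c
  [a-b]c≈0⇒ac≈bc {a} {b} {c} e = x∙y⁻¹≈ε⇒x≈y (a * c) (b * c) (trans (sym ([y-z]x≈yx-zx c a b)) e)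

  p+t-q-s≈0⇒p-q≈s-t : ∀ P Q S T → ((P + T) - Q) - S ≈ 0# → P - Q ≈ S - T
  p+t-q-s≈0⇒p-q≈s-t P Q S T e = x∙y⁻¹≈ε⇒x≈y (P - Q) (S - T) (begin
    (P - Q) - (S - T)     ≈⟨ +-congˡ (-‿anti-homo-+ S (- T)) ⟩
    (P - Q) + (- - T - S) ≈⟨ +-congˡ (+-congʳ (-‿involutive T)) ⟩
    (P - Q) + (T - S)     ≈⟨ solve 4 (λ p q s t → (p ⊕ q) ⊕ (t ⊕ s) ⊜ ((p ⊕ t) ⊕ q) ⊕ s) refl P (- Q) (- S) T ⟩
    ((P + T) - Q) - S     ≈⟨ e ⟩
    0#                    ∎)

  -- The first two generators of I_C are the cases (u, v, w, t) = (b, b, a, a) and (b, c, a, b).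
  intertwining-from-generator : ∀ u v w t →
    ((u * (v * w) + w * (v * t)) - u * (w * v)) - v * (w * t) ≈ 0# → u * [ v , w ] ≈ [ v , w ] * t
  intertwining-from-generator u v w t e = begin
    u * [ v , w ]                   ≈⟨ x[y-z]≈xy-xz u (v * w) (w * v) ⟩
    u * (v * w) - u * (w * v)       ≈⟨ p+t-q-s≈0⇒p-q≈s-t _ _ _ _ e ⟩
    v * (w * t) - w * (v * t)       ≈⟨ +-cong (*-assoc v w t) (-‿cong (*-assoc w v t)) ⟨
    (v * w) * t - (w * v) * t       ≈⟨ [y-z]x≈yx-zx t (v * w) (w * v) ⟨
    [ v , w ] * t                   ∎

  annihilation-from-generator : ∀ a b c →
    ((c * (b * (c * a)) + b * (c * (a * c))) - c * (b * (a * c))) - b * (c * (c * a)) ≈ 0# →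
    [ c , b ] * [ c , a ] ≈ 0#
  annihilation-from-generator a b c e = begin
    [ c , b ] * [ c , a ]
      ≈⟨ [y-z]x≈yx-zx [ c , a ] (c * b) (b * c) ⟩
    (c * b) * [ c , a ] - (b * c) * [ c , a ]
      ≈⟨ +-cong (*-assoc c b _) (-‿cong (*-assoc b c _)) ⟩
    c * (b * [ c , a ]) - b * (c * [ c , a ])
      ≈⟨ +-cong (*-congˡ (x[y-z]≈xy-xz b (c * a) (a * c))) (-‿cong (*-congˡ (x[y-z]≈xy-xz c (c * a) (a * c)))) ⟩
    c * (b * (c * a) - b * (a * c)) - b * (c * (c * a) - c * (a * c))
      ≈⟨ +-cong (x[y-z]≈xy-xz c _ _) (-‿cong (x[y-z]≈xy-xz b _ _)) ⟩
    (c * (b * (c * a)) - c * (b * (a * c))) - (b * (c * (c * a)) - b * (c * (a * c)))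
      ≈⟨ x≈y⇒x∙y⁻¹≈ε (p+t-q-s≈0⇒p-q≈s-t _ _ _ _ e) ⟩
    0# ∎

  commutatorSum-*-cong : ∀ {x s t zs} → All (λ z → [ z , x ] * s ≈ [ z , x ] * t) zs →
                         commutatorSum x zs * s ≈ commutatorSum x zs * t
  commutatorSum-*-cong {s = s} {t} []       = trans (zeroˡ s) (sym (zeroˡ t))
  commutatorSum-*-cong {s = s} {t} (e ∷ es) =
    trans (distribʳ s _ _) (trans (+-cong e (commutatorSum-*-cong es)) (sym (distribʳ t _ _)))

  commutatorSum-commute : ∀ {x y zs} → All (λ z → y * [ z , x ] ≈ [ z , x ] * y) zs →
                          y * commutatorSum x zs ≈ commutatorSum x zs * y
  commutatorSum-commute {y = y} []       = trans (zeroʳ y) (sym (zeroˡ y))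
  commutatorSum-commute {y = y} (e ∷ es) =
    trans (distribˡ y _ _) (trans (+-cong e (commutatorSum-commute es)) (sym (distribʳ y _ _)))

  commutator-swap : ∀ {x y z} → y * [ z , x ] ≈ [ z , x ] * y → z * [ z , x ] ≈ [ z , x ] * x →
                    [ z , y ] * [ z , x ] ≈ 0# → [ z , x ] * (x * y) ≈ [ z , x ] * (y * x)
  commutator-swap {x} {y} {z} y-comm z-absorb annihil = begin
    [ z , x ] * (x * y)   ≈⟨ *-assoc _ x y ⟨
    ([ z , x ] * x) * y   ≈⟨ *-congʳ z-absorb ⟨
    (z * [ z , x ]) * y   ≈⟨ *-assoc z _ y ⟩
    z * ([ z , x ] * y)   ≈⟨ *-congˡ y-comm ⟨
    z * (y * [ z , x ])   ≈⟨ *-assoc z y _ ⟨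
    (z * y) * [ z , x ]   ≈⟨ [a-b]c≈0⇒ac≈bc annihil ⟩
    (y * z) * [ z , x ]   ≈⟨ *-assoc y z _ ⟩
    y * (z * [ z , x ])   ≈⟨ *-congˡ z-absorb ⟩
    y * ([ z , x ] * x)   ≈⟨ *-assoc y _ x ⟨
    (y * [ z , x ]) * x   ≈⟨ *-congʳ y-comm ⟩
    ([ z , x ] * y) * x   ≈⟨ *-assoc _ y x ⟩
    [ z , x ] * (y * x)   ∎

  -- The right-hand side is the recursion for complete (y ∷ x ∷ zs) (suc k): after left
  -- multiplication by L the first two variables may be exchanged.
  complete-swap-under : ∀ {L x y z} zs → L * x ≈ z * L → L * (x * y) ≈ L * (y * x) → ∀ k →
                   L * complete (x ∷ y ∷ zs) (suc k) ≈ L * (y * complete (x ∷ y ∷ zs) k + complete (x ∷ zs) (suc k))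
  complete-swap-under {L} {x} {y} {z} zs Lx≈zL Lxy≈Lyx = go
    where
    G H : ℕ → Carrier
    G = complete (x ∷ y ∷ zs)
    H = complete (y ∷ zs)

    under-x : ∀ {s t} → L * s ≈ L * t → L * (x * s) ≈ L * (x * t)
    under-x {s} {t} e = begin
      L * (x * s)  ≈⟨ *-assoc L x s ⟨
      (L * x) * s  ≈⟨ *-congʳ Lx≈zL ⟩
      (z * L) * s  ≈⟨ *-assoc z L s ⟩
      z * (L * s)  ≈⟨ *-congˡ e ⟩
      z * (L * t)  ≈⟨ *-assoc z L t ⟨
      (z * L) * t  ≈⟨ *-congʳ Lx≈zL ⟨
      (L * x) * t  ≈⟨ *-assoc L x t ⟩
      L * (x * t)  ∎

    under-+ʳ : ∀ {s t} c → L * s ≈ L * t → L * (s + c) ≈ L * (t + c)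
    under-+ʳ c e = trans (distribˡ L _ c) (trans (+-congʳ e) (sym (distribˡ L _ c)))

    swap : ∀ t → L * (x * (y * t)) ≈ L * (y * (x * t))
    swap t = begin
      L * (x * (y * t))  ≈⟨ *-congˡ (*-assoc x y t) ⟨
      L * ((x * y) * t)  ≈⟨ *-assoc L _ t ⟨
      (L * (x * y)) * t  ≈⟨ *-congʳ Lxy≈Lyx ⟩
      (L * (y * x)) * t  ≈⟨ *-assoc L _ t ⟩
      L * ((y * x) * t)  ≈⟨ *-congˡ (*-assoc y x t) ⟩
      L * (y * (x * t))  ∎

    go : ∀ k → L * G (suc k) ≈ L * (y * G k + complete (x ∷ zs) (suc k))
    go zero = *-congˡ (solve 3 (λ a b c → a ⊕ (b ⊕ c) ⊜ b ⊕ (a ⊕ c)) refl (x * 1#) (y * 1#) (complete zs 1))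
    go (suc k) = begin
      L * (x * G (suc k) + H (suc (suc k)))
        ≈⟨ under-+ʳ _ (under-x (go k)) ⟩
      L * (x * (y * G k + complete (x ∷ zs) (suc k)) + H (suc (suc k)))
        ≈⟨ *-congˡ (+-congʳ (distribˡ x _ _)) ⟩
      L * ((x * (y * G k) + x * complete (x ∷ zs) (suc k)) + (y * H (suc k) + complete zs (suc (suc k))))
        ≈⟨ under-+ʳ _ (under-+ʳ _ (swap (G k))) ⟩
      L * ((y * (x * G k) + x * complete (x ∷ zs) (suc k)) + (y * H (suc k) + complete zs (suc (suc k))))
        ≈⟨ *-congˡ (interchange _ _ _ _) ⟩
      L * ((y * (x * G k) + y * H (suc k)) + (x * complete (x ∷ zs) (suc k) + complete zs (suc (suc k))))
        ≈⟨ *-congˡ (+-congʳ (distribˡ y _ _)) ⟨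
      L * (y * G (suc k) + complete (x ∷ zs) (suc (suc k))) ∎

  complete-exchange : ∀ {x ys} → LowestRelations x ys → ∀ m →
    complete ys (suc m) * x ≈ x * complete ys (suc m) + commutatorSum x ys * complete (x ∷ ys) m
  complete-exchange {x} {[]} _ m = begin
    0# * x                     ≈⟨ zeroˡ x ⟩
    0#                         ≈⟨ +-identityʳ 0# ⟨
    0# + 0#                    ≈⟨ +-cong (zeroʳ x) (zeroˡ _) ⟨
    x * 0# + 0# * complete (x ∷ []) m ∎
  complete-exchange {x} {y ∷ zs}
    rels@record { absorb = y-absorb ∷ z-absorb ; commute = y-commute ∷ _ ; annihilate = y-annihil ∷ _ } = go
    where
    c C′ : Carrier
    c  = [ y , x ]
    C′ = commutatorSum x zs
    G H : ℕ → Carrier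
    G  = complete (x ∷ y ∷ zs)
    H  = complete (y ∷ zs)

    exchange-tail : ∀ m → complete zs (suc m) * x ≈ x * complete zs (suc m) + C′ * complete (x ∷ zs) m
    exchange-tail = complete-exchange (lowestRelations-tail rels)

    C′-swap : ∀ k → C′ * G (suc k) ≈ C′ * (y * G k + complete (x ∷ zs) (suc k))
    C′-swap k = commutatorSum-*-cong (All.zipWith
      (λ (z-abs , comm , ann) → complete-swap-under zs (sym z-abs) (commutator-swap comm z-abs ann) k)
      (z-absorb , All.zip (y-commute , y-annihil)))

    y-past-x : ∀ t → y * (x * t) ≈ x * (y * t) + c * t
    y-past-x t = begin
      y * (x * t)        ≈⟨ *-assoc y x t ⟨
      (y * x) * t        ≈⟨ *-congʳ (yx≈xy+[y,x] y x) ⟩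
      (x * y + c) * t    ≈⟨ distribʳ t _ c ⟩
      (x * y) * t + c * t ≈⟨ +-congʳ (*-assoc x y t) ⟩
      x * (y * t) + c * t ∎

    y-past-C : ∀ t → y * ((c + C′) * t) ≈ c * (x * t) + C′ * (y * t)
    y-past-C t = begin
      y * ((c + C′) * t)          ≈⟨ *-assoc y _ t ⟨
      (y * (c + C′)) * t          ≈⟨ *-congʳ (distribˡ y c C′) ⟩
      (y * c + y * C′) * t        ≈⟨ *-congʳ (+-cong y-absorb (commutatorSum-commute y-commute)) ⟩
      (c * x + C′ * y) * t        ≈⟨ distribʳ t _ _ ⟩
      (c * x) * t + (C′ * y) * t  ≈⟨ +-cong (*-assoc c x t) (*-assoc C′ y t) ⟩
      c * (x * t) + C′ * (y * t)  ∎

    go : ∀ m → H (suc m) * x ≈ x * H (suc m) + (c + C′) * G m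
    go zero = begin
      (y * 1# + complete zs 1) * x
        ≈⟨ distribʳ x _ _ ⟩
      (y * 1#) * x + complete zs 1 * x
        ≈⟨ +-cong (*-congʳ (*-identityʳ y)) (exchange-tail 0) ⟩
      y * x + (x * complete zs 1 + C′ * 1#)
        ≈⟨ +-congʳ (yx≈xy+[y,x] y x) ⟩
      (x * y + c) + (x * complete zs 1 + C′ * 1#)
        ≈⟨ interchange _ _ _ _ ⟩
      (x * y + x * complete zs 1) + (c + C′ * 1#)
        ≈⟨ +-cong (distribˡ x y _) (+-congʳ (*-identityʳ c)) ⟨
      x * (y + complete zs 1) + (c * 1# + C′ * 1#)
        ≈⟨ +-cong (*-congˡ (+-congʳ (*-identityʳ y))) (distribʳ 1# c C′) ⟨
      x * (y * 1# + complete zs 1) + (c + C′) * 1# ∎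
    go (suc m) = begin
      (y * H (suc m) + complete zs (suc (suc m))) * x
        ≈⟨ distribʳ x _ _ ⟩
      (y * H (suc m)) * x + complete zs (suc (suc m)) * x
        ≈⟨ +-cong (*-assoc y _ x) (exchange-tail (suc m)) ⟩
      y * (H (suc m) * x) + (x * complete zs (suc (suc m)) + C′ * complete (x ∷ zs) (suc m))
        ≈⟨ +-congʳ (trans (*-congˡ (go m)) (distribˡ y _ _)) ⟩
      (y * (x * H (suc m)) + y * ((c + C′) * G m)) + (x * complete zs (suc (suc m)) + C′ * complete (x ∷ zs) (suc m))
        ≈⟨ +-congʳ (+-cong (y-past-x _) (y-past-C _)) ⟩
      ((x * (y * H (suc m)) + c * H (suc m)) + (c * (x * G m) + C′ * (y * G m)))
        + (x * complete zs (suc (suc m)) + C′ * complete (x ∷ zs) (suc m))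
        ≈⟨ solve 6 (λ a b d e f g → ((a ⊕ e) ⊕ (d ⊕ f)) ⊕ (b ⊕ g) ⊜ (a ⊕ b) ⊕ ((d ⊕ e) ⊕ (f ⊕ g))) refl _ _ _ _ _ _ ⟩
      (x * (y * H (suc m)) + x * complete zs (suc (suc m)))
        + ((c * (x * G m) + c * H (suc m)) + (C′ * (y * G m) + C′ * complete (x ∷ zs) (suc m)))
        ≈⟨ +-cong (distribˡ x _ _) (+-cong (distribˡ c _ _) (distribˡ C′ _ _)) ⟨
      x * H (suc (suc m)) + (c * G (suc m) + C′ * (y * G m + complete (x ∷ zs) (suc m)))
        ≈⟨ +-congˡ (+-congˡ (C′-swap m)) ⟨
      x * H (suc (suc m)) + (c * G (suc m) + C′ * G (suc m))
        ≈⟨ +-congˡ (distribʳ _ c C′) ⟨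
      x * H (suc (suc m)) + (c + C′) * G (suc m) ∎

  complete-product-expansion : ∀ {x xs} → LowestRelations x xs → ∀ k l →
    let H = complete (x ∷ xs) ; H′ = complete xs in
    H (suc k) * H (suc l) + x * (x * (H k * H l))
      ≈ ((x * (H k * H (suc l)) + x * (H (suc k) * H l)) + commutatorSum x xs * (H k * H l)) + H′ (suc k) * H′ (suc l)
  complete-product-expansion {x} {xs} rels k l = begin
    H (suc k) * H (suc l) + Y
      ≈⟨ +-congʳ (trans (distribʳ _ _ _) (+-congʳ (*-assoc x _ _))) ⟩
    (x * (H k * H (suc l)) + H′ (suc k) * H (suc l)) + Y
      ≈⟨ +-congʳ (+-congˡ (trans (distribˡ _ _ _) (+-congʳ tail-past-x))) ⟩
    (x * (H k * H (suc l)) + ((x * (H′ (suc k) * H l) + C * (H k * H l)) + H′ (suc k) * H′ (suc l))) + Y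
      ≈⟨ solve 5 (λ a b d e f → (a ⊕ ((b ⊕ d) ⊕ e)) ⊕ f ⊜ ((a ⊕ (f ⊕ b)) ⊕ d) ⊕ e) refl _ _ _ _ _ ⟩
    ((x * (H k * H (suc l)) + (Y + x * (H′ (suc k) * H l))) + C * (H k * H l)) + H′ (suc k) * H′ (suc l)
      ≈⟨ +-congʳ (+-congʳ (+-congˡ recombine)) ⟩
    ((x * (H k * H (suc l)) + x * (H (suc k) * H l)) + C * (H k * H l)) + H′ (suc k) * H′ (suc l) ∎
    where
    H H′ : ℕ → Carrier
    H  = complete (x ∷ xs)
    H′ = complete xs
    C Y : Carrier
    C = commutatorSum x xs
    Y = x * (x * (H k * H l))

    tail-past-x : H′ (suc k) * (x * H l) ≈ x * (H′ (suc k) * H l) + C * (H k * H l)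
    tail-past-x = begin
      H′ (suc k) * (x * H l)              ≈⟨ *-assoc _ x _ ⟨
      (H′ (suc k) * x) * H l              ≈⟨ *-congʳ (complete-exchange rels k) ⟩
      (x * H′ (suc k) + C * H k) * H l    ≈⟨ distribʳ _ _ _ ⟩
      (x * H′ (suc k)) * H l + (C * H k) * H l ≈⟨ +-cong (*-assoc x _ _) (*-assoc C _ _) ⟩
      x * (H′ (suc k) * H l) + C * (H k * H l) ∎

    recombine : Y + x * (H′ (suc k) * H l) ≈ x * (H (suc k) * H l)
    recombine = begin
      x * (x * (H k * H l)) + x * (H′ (suc k) * H l)  ≈⟨ distribˡ x _ _ ⟨
      x * (x * (H k * H l) + H′ (suc k) * H l)        ≈⟨ *-congˡ (+-congʳ (*-assoc x _ _)) ⟨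
      x * ((x * H k) * H l + H′ (suc k) * H l)        ≈⟨ *-congˡ (distribʳ _ _ _) ⟨
      x * (H (suc k) * H l)                           ∎

  1#-commutes : ∀ a → 1# * a ≈ a * 1#
  1#-commutes a = trans (*-identityˡ a) (sym (*-identityʳ a))

  complete-commute : ∀ {xs} → Relations xs → ∀ k l → complete xs k * complete xs l ≈ complete xs l * complete xs k
  complete-commute _ zero l = 1#-commutes _
  complete-commute _ (suc k) zero = sym (1#-commutes _)
  complete-commute [] (suc k) (suc l) = refl
  complete-commute {x ∷ xs} (low ∷ rels) (suc k) (suc l) = +-cancelʳ (x * (x * (H k * H l))) _ _ (begin
    H (suc k) * H (suc l) + x * (x * (H k * H l))
      ≈⟨ complete-product-expansion low k l ⟩
    ((x * (H k * H (suc l)) + x * (H (suc k) * H l)) + C * (H k * H l)) + H′ (suc k) * H′ (suc l)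
      ≈⟨ +-cong (+-cong (trans (+-comm _ _) (+-cong (*-congˡ (comm (suc k) l)) (*-congˡ (comm k (suc l)))))
                        (*-congˡ (comm k l)))
                (complete-commute rels (suc k) (suc l)) ⟩
    ((x * (H l * H (suc k)) + x * (H (suc l) * H k)) + C * (H l * H k)) + H′ (suc l) * H′ (suc k)
      ≈⟨ complete-product-expansion low l k ⟨
    H (suc l) * H (suc k) + x * (x * (H l * H k))
      ≈⟨ +-congˡ (*-congˡ (*-congˡ (comm k l))) ⟨
    H (suc l) * H (suc k) + x * (x * (H k * H l)) ∎)
    where
    H H′ : ℕ → Carrier
    H  = complete (x ∷ xs)
    H′ = complete xs
    C : Carrier
    C = commutatorSum x xs
    comm : ∀ k l → H k * H l ≈ H l * H k
    comm = complete-commute (low ∷ rels)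

-- Imported only after the ring-generic part, whose ring equality _≈_ would clash with Defs._≈_.
open import Defs
open import Algebra.Structures using (IsRing)
open import Data.Bool using (Bool; true; false; _∧_; if_then_else_)
open import Data.Bool.Properties using (∧-zeroʳ)
open import Data.Fin using (Fin; toℕ; fromℕ<) renaming (_<_ to _<ᶠ_)
import Data.Fin.Properties as Fin
open import Data.Integer using (ℤ; 0ℤ; 1ℤ) renaming (_+_ to _+ℤ_; _*_ to _*ℤ_; -_ to -ℤ_)
import Data.Integer.Properties as ℤ
open import Data.Integer.Tactic.RingSolver using (solve-∀)
open import Data.List using (_++_; map; concat; length; filterᵇ; concatMap; allFin; applyUpTo; upTo)
import Data.List.Properties as List
open import Data.List.Membership.Propositional using (_∈_)
open import Data.List.Membership.Propositional.Properties using (∈-allFin)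
open import Data.List.Relation.Unary.Any using (here; there)
open import Data.List.Relation.Unary.Unique.Propositional using (Unique)
open import Data.List.Relation.Unary.Unique.Propositional.Properties using (allFin⁺)
open import Data.Nat using (_+_; _∸_; _≤ᵇ_; _≡ᵇ_; _<_; _≤_; _≥_; z≤n; s≤s)
import Data.Nat.Properties as ℕ
open import Data.Product using (_×_)
open import Function using (_∘_)
open import Relation.Nullary using (does; yes; no; contradiction)
open import Relation.Nullary.Decidable using (dec-true; dec-false)
open import Relation.Binary.PropositionalEquality
  using (_≡_; _≢_; refl; sym; trans; cong; cong₂; subst; subst₂; module ≡-Reasoning)
open import Algebra.Properties.CommutativeSemigroup ℤ.+-commutativeSemigroup using () renaming (interchange to +ℤ-interchange)

module FreeRing {N : ℕ} where

  scale : ℤ → Word N → ℤ × Word N → ℤ × Word N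
  scale a v (b , w) = (a *ℤ b , v ++ w)

  negate : ℤ × Word N → ℤ × Word N
  negate (a , w) = (-ℤ a , w)

  ≡⇒≈ : ∀ {x y : U N} → x ≡ y → x ≈ y
  ≡⇒≈ refl w = refl

  coeff-+U : ∀ (x y : U N) w → coeff (x +U y) w ≡ coeff x w +ℤ coeff y w
  coeff-+U []            y w = sym (ℤ.+-identityˡ _)
  coeff-+U ((a , v) ∷ x) y w rewrite coeff-+U x y w = sym (ℤ.+-assoc (if v ≟w w then a else 0ℤ) _ _)

  coeff-negU : ∀ (x : U N) w → coeff (-U x) w ≡ -ℤ coeff x w
  coeff-negU []            w = refl
  coeff-negU ((a , v) ∷ x) w with v ≟w w
  ... | true  = trans (cong (-ℤ a +ℤ_) (coeff-negU x w)) (sym (ℤ.neg-distrib-+ a (coeff x w)))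
  ... | false = trans (cong (0ℤ +ℤ_) (coeff-negU x w)) (sym (ℤ.neg-distrib-+ 0ℤ (coeff x w)))

  coeff--U : ∀ (x y : U N) w → coeff (x -U y) w ≡ coeff x w +ℤ -ℤ coeff y w
  coeff--U x y w = trans (coeff-+U x (-U y) w) (cong (coeff x w +ℤ_) (coeff-negU y w))

  *U-distribʳ : ∀ (x y z : U N) → (x +U y) *U z ≡ x *U z +U y *U z
  *U-distribʳ x y z = List.concatMap-++ _ x y

  *U-distribˡ : ∀ (x y z : U N) → (x *U (y +U z)) ≈ (x *U y +U x *U z)
  *U-distribˡ []            y z w = refl
  *U-distribˡ ((a , v) ∷ x) y z w = begin
    coeff (map (scale a v) (y ++ z) ++ x *U (y +U z)) w
      ≡⟨ coeff-+U (map (scale a v) (y ++ z)) (x *U (y +U z)) w ⟩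
    coeff (map (scale a v) (y ++ z)) w +ℤ coeff (x *U (y +U z)) w
      ≡⟨ cong₂ _+ℤ_ (cong (λ s → coeff s w) (List.map-++ (scale a v) y z)) (*U-distribˡ x y z w) ⟩
    coeff (map (scale a v) y ++ map (scale a v) z) w +ℤ coeff (x *U y +U x *U z) w
      ≡⟨ cong₂ _+ℤ_ (coeff-+U (map (scale a v) y) (map (scale a v) z) w) (coeff-+U (x *U y) (x *U z) w) ⟩
    (coeff (map (scale a v) y) w +ℤ coeff (map (scale a v) z) w) +ℤ (coeff (x *U y) w +ℤ coeff (x *U z) w)
      ≡⟨ +ℤ-interchange (coeff (map (scale a v) y) w) (coeff (map (scale a v) z) w) (coeff (x *U y) w) (coeff (x *U z) w) ⟩
    (coeff (map (scale a v) y) w +ℤ coeff (x *U y) w) +ℤ (coeff (map (scale a v) z) w +ℤ coeff (x *U z) w)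
      ≡⟨ cong₂ _+ℤ_ (coeff-+U (map (scale a v) y) (x *U y) w) (coeff-+U (map (scale a v) z) (x *U z) w) ⟨
    coeff (((a , v) ∷ x) *U y) w +ℤ coeff (((a , v) ∷ x) *U z) w
      ≡⟨ coeff-+U (((a , v) ∷ x) *U y) (((a , v) ∷ x) *U z) w ⟨
    coeff (((a , v) ∷ x) *U y +U ((a , v) ∷ x) *U z) w ∎
    where open ≡-Reasoning

  *U-zeroʳ : ∀ (x : U N) → x *U 𝟘 ≡ 𝟘
  *U-zeroʳ []            = refl
  *U-zeroʳ ((a , v) ∷ x) = *U-zeroʳ x

  scale-*U : ∀ a v (y z : U N) → map (scale a v) y *U z ≡ map (scale a v) (y *U z)
  scale-*U a v []            z = refl
  scale-*U a v ((b , w) ∷ y) z = begin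
    map (scale (a *ℤ b) (v ++ w)) z ++ map (scale a v) y *U z
      ≡⟨ cong₂ _++_ (trans (List.map-cong scale-scale z) (List.map-∘ z)) (scale-*U a v y z) ⟩
    map (scale a v) (map (scale b w) z) ++ map (scale a v) (y *U z)
      ≡⟨ List.map-++ (scale a v) (map (scale b w) z) (y *U z) ⟨
    map (scale a v) (map (scale b w) z ++ y *U z) ∎
    where
    open ≡-Reasoning
    scale-scale : ∀ p → scale (a *ℤ b) (v ++ w) p ≡ scale a v (scale b w p)
    scale-scale (c , u) = cong₂ _,_ (ℤ.*-assoc a b c) (List.++-assoc v w u)

  *U-assoc : ∀ (x y z : U N) → (x *U y) *U z ≡ x *U (y *U z)
  *U-assoc []            y z = refl
  *U-assoc ((a , v) ∷ x) y z = begin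
    (map (scale a v) y ++ x *U y) *U z           ≡⟨ *U-distribʳ (map (scale a v) y) (x *U y) z ⟩
    map (scale a v) y *U z ++ (x *U y) *U z      ≡⟨ cong₂ _++_ (scale-*U a v y z) (*U-assoc x y z) ⟩
    map (scale a v) (y *U z) ++ x *U (y *U z)    ∎
    where open ≡-Reasoning

  *U-identityˡ : ∀ (x : U N) → 𝟙 *U x ≡ x
  *U-identityˡ x = trans (List.++-identityʳ _)
    (trans (List.map-cong (λ { (b , w) → cong (_, w) (ℤ.*-identityˡ b) }) x) (List.map-id x))

  *U-identityʳ : ∀ (x : U N) → x *U 𝟙 ≡ x
  *U-identityʳ []            = refl
  *U-identityʳ ((a , v) ∷ x) = cong₂ _∷_ (cong₂ _,_ (ℤ.*-identityʳ a) (List.++-identityʳ v)) (*U-identityʳ x)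

  negU-*U : ∀ (x y : U N) → (-U x) *U y ≡ -U (x *U y)
  negU-*U []            y = refl
  negU-*U ((a , v) ∷ x) y = begin
    map (scale (-ℤ a) v) y ++ (-U x) *U y
      ≡⟨ cong₂ _++_ (trans (List.map-cong neg-scale y) (List.map-∘ y)) (negU-*U x y) ⟩
    -U (map (scale a v) y) ++ -U (x *U y)
      ≡⟨ List.map-++ _ (map (scale a v) y) (x *U y) ⟨
    -U (map (scale a v) y ++ x *U y)
      ∎
    where
    open ≡-Reasoning
    neg-scale : ∀ p → scale (-ℤ a) v p ≡ negate (scale a v p)
    neg-scale (b , w) = cong (_, v ++ w) (sym (ℤ.neg-distribˡ-* a b))

  *U-negU : ∀ (x y : U N) → x *U (-U y) ≡ -U (x *U y)
  *U-negU []            y = refl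
  *U-negU ((a , v) ∷ x) y = begin
    map (scale a v) (-U y) ++ x *U (-U y)
      ≡⟨ cong₂ _++_ (trans (sym (List.map-∘ y)) (trans (List.map-cong scale-neg y) (List.map-∘ y))) (*U-negU x y) ⟩
    -U (map (scale a v) y) ++ -U (x *U y)
      ≡⟨ List.map-++ _ (map (scale a v) y) (x *U y) ⟨
    -U (map (scale a v) y ++ x *U y)
      ∎
    where
    open ≡-Reasoning
    scale-neg : ∀ p → scale a v (negate p) ≡ negate (scale a v p)
    scale-neg (b , w) = cong (_, v ++ w) (sym (ℤ.neg-distribʳ-* a b))

module Quotient {N : ℕ} (I : U N → Set) (ideal : IsIdeal I) where

  open FreeRing
  private module Ideal = IsIdeal ideal

  -- A record, so that x and y can be inferred from a proof of x ~ y.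
  infix 4 _~_
  record _~_ (x y : U N) : Set where
    constructor quot
    field difference∈ : I (x -U y)
  open _~_ public

  ≈⇒~ : ∀ {x y} → x ≈ y → x ~ y
  ≈⇒~ {x} {y} e = quot (Ideal.resp (λ w → sym (begin
    coeff (x -U y) w            ≡⟨ coeff--U x y w ⟩
    coeff x w +ℤ -ℤ coeff y w   ≡⟨ cong (_+ℤ -ℤ coeff y w) (e w) ⟩
    coeff y w +ℤ -ℤ coeff y w   ≡⟨ ℤ.+-inverseʳ (coeff y w) ⟩
    0ℤ                          ∎)) Ideal.zero∈)
    where open ≡-Reasoning

  ~-refl : ∀ {x} → x ~ x
  ~-refl = ≈⇒~ (λ w → refl)

  ~-sym : ∀ {x y} → x ~ y → y ~ x
  ~-sym {x} {y} (quot d) = quot (Ideal.resp (λ w → begin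
    coeff (-U (x -U y)) w          ≡⟨ trans (coeff-negU (x -U y) w) (cong -ℤ_ (coeff--U x y w)) ⟩
    -ℤ (coeff x w +ℤ -ℤ coeff y w)  ≡⟨ neg-diff (coeff x w) (coeff y w) ⟩
    coeff y w +ℤ -ℤ coeff x w       ≡⟨ coeff--U y x w ⟨
    coeff (y -U x) w ∎) (Ideal.-∈ d))
    where
    open ≡-Reasoning
    neg-diff : ∀ a b → -ℤ (a +ℤ -ℤ b) ≡ b +ℤ -ℤ a
    neg-diff = solve-∀

  ~-trans : ∀ {x y z} → x ~ y → y ~ z → x ~ z
  ~-trans {x} {y} {z} (quot d) (quot e) = quot (Ideal.resp (λ w → begin
    coeff ((x -U y) +U (y -U z)) w
      ≡⟨ trans (coeff-+U (x -U y) (y -U z) w) (cong₂ _+ℤ_ (coeff--U x y w) (coeff--U y z w)) ⟩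
    (coeff x w +ℤ -ℤ coeff y w) +ℤ (coeff y w +ℤ -ℤ coeff z w)
      ≡⟨ telescope (coeff x w) (coeff y w) (coeff z w) ⟩
    coeff x w +ℤ -ℤ coeff z w
      ≡⟨ coeff--U x z w ⟨
    coeff (x -U z) w ∎) (Ideal.+∈ d e))
    where
    open ≡-Reasoning
    telescope : ∀ a b c → (a +ℤ -ℤ b) +ℤ (b +ℤ -ℤ c) ≡ a +ℤ -ℤ c
    telescope = solve-∀

  ~-+-cong : ∀ {x y z v} → x ~ y → z ~ v → x +U z ~ y +U v
  ~-+-cong {x} {y} {z} {v} (quot d) (quot e) = quot (Ideal.resp (λ w → begin
    coeff ((x -U y) +U (z -U v)) w
      ≡⟨ trans (coeff-+U (x -U y) (z -U v) w) (cong₂ _+ℤ_ (coeff--U x y w) (coeff--U z v w)) ⟩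
    (coeff x w +ℤ -ℤ coeff y w) +ℤ (coeff z w +ℤ -ℤ coeff v w)
      ≡⟨ regroup (coeff x w) (coeff y w) (coeff z w) (coeff v w) ⟩
    (coeff x w +ℤ coeff z w) +ℤ -ℤ (coeff y w +ℤ coeff v w)
      ≡⟨ trans (coeff--U (x +U z) (y +U v) w) (cong₂ (λ a b → a +ℤ -ℤ b) (coeff-+U x z w) (coeff-+U y v w)) ⟨
    coeff ((x +U z) -U (y +U v)) w ∎) (Ideal.+∈ d e))
    where
    open ≡-Reasoning
    regroup : ∀ a b c d → (a +ℤ -ℤ b) +ℤ (c +ℤ -ℤ d) ≡ (a +ℤ c) +ℤ -ℤ (b +ℤ d)
    regroup = solve-∀

  ~-negU-cong : ∀ {x y} → x ~ y → -U x ~ -U y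
  ~-negU-cong {x} {y} (quot d) = quot (subst I (List.map-++ _ x (-U y)) (Ideal.-∈ d))

  ~-*-cong : ∀ {x y z v} → x ~ y → z ~ v → x *U z ~ y *U v
  ~-*-cong {x} {y} {z} {v} (quot d) (quot e) = ~-trans
    (quot (subst I (trans (*U-distribʳ x (-U y) z) (cong (x *U z ++_) (negU-*U y z))) (Ideal.*ʳ∈ z d)))
    (quot (Ideal.resp (λ w → trans (*U-distribˡ y z (-U v) w) (cong (λ s → coeff (y *U z ++ s) w) (*U-negU y v)))
                      (Ideal.*ˡ∈ y e)))

  quotient-isRing : IsRing _~_ _+U_ _*U_ -U_ 𝟘 𝟙
  quotient-isRing = record
    { +-isAbelianGroup = record
      { isGroup = record
        { isMonoid = record
          { isSemigroup = record
            { isMagma = record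
              { isEquivalence = record { refl = ~-refl ; sym = ~-sym ; trans = ~-trans }
              ; ∙-cong = ~-+-cong }
            ; assoc = λ x y z → ≈⇒~ (≡⇒≈ (List.++-assoc x y z)) }
          ; identity = (λ x → ~-refl) , (λ x → ≈⇒~ (≡⇒≈ (List.++-identityʳ x))) }
        ; inverse =
            (λ x → ≈⇒~ (λ w → trans (coeff-+U (-U x) x w)
                                    (trans (cong (_+ℤ coeff x w) (coeff-negU x w)) (ℤ.+-inverseˡ (coeff x w)))))
          , (λ x → ≈⇒~ (λ w → trans (coeff--U x x w) (ℤ.+-inverseʳ (coeff x w))))
        ; ⁻¹-cong = ~-negU-cong }
      ; comm = λ x y → ≈⇒~ (λ w →
          trans (coeff-+U x y w) (trans (ℤ.+-comm (coeff x w) (coeff y w)) (sym (coeff-+U y x w)))) }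
    ; *-cong = ~-*-cong
    ; *-assoc = λ x y z → ≈⇒~ (≡⇒≈ (*U-assoc x y z))
    ; *-identity = (λ x → ≈⇒~ (≡⇒≈ (*U-identityˡ x))) , (λ x → ≈⇒~ (≡⇒≈ (*U-identityʳ x)))
    ; distrib = (λ x y z → ≈⇒~ (*U-distribˡ x y z)) , (λ x y z → ≈⇒~ (≡⇒≈ (*U-distribʳ y z x)))
    }

  quotientRing : Ring _ _
  quotientRing = record { isRing = quotient-isRing }

indicator : Bool → ℤ
indicator b = if b then 1ℤ else 0ℤ

≤ᵇ-suc : ∀ {a t} → t ≢ a → (suc a ≤ᵇ t) ≡ (a ≤ᵇ t)
≤ᵇ-suc {a} {t} t≢a with a ℕ.≤? t
... | yes a≤t = trans (dec-true (suc a ℕ.≤? t) (ℕ.≤∧≢⇒< a≤t (λ a≡t → t≢a (sym a≡t)))) (sym (dec-true (a ℕ.≤? t) a≤t))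
... | no  a≰t = trans (dec-false (suc a ℕ.≤? t) (λ a<t → a≰t (ℕ.<⇒≤ a<t))) (sym (dec-false (a ℕ.≤? t) a≰t))

module Monomials {N : ℕ} where
  open FreeRing

  generator : Fin N → U N
  generator i = mono (i ∷ [])

  monomialSum : List (Word N) → U N
  monomialSum ws = sumU (map mono ws)

  coeff-monomialSum-++ : ∀ vs ws w →
    coeff (monomialSum (vs ++ ws)) w ≡ coeff (monomialSum vs) w +ℤ coeff (monomialSum ws) w
  coeff-monomialSum-++ vs ws w = trans
    (cong (λ s → coeff (sumU s) w) (List.map-++ mono vs ws))
    (trans (cong (λ s → coeff s w) (sym (List.concat-++ (map mono vs) (map mono ws)))) (coeff-+U (monomialSum vs) _ w))

  ≟w-refl : ∀ (v : Word N) → (v ≟w v) ≡ true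
  ≟w-refl v = dec-true (List.≡-dec Fin._≟_ v v) refl

  ≟w-≢ : ∀ {v w : Word N} → v ≢ w → (v ≟w w) ≡ false
  ≟w-≢ {v} {w} = dec-false (List.≡-dec Fin._≟_ v w)

  coeff-monomialSum-filter : ∀ p ws w →
    coeff (monomialSum (filterᵇ p ws)) w ≡ (if p w then coeff (monomialSum ws) w else 0ℤ)
  coeff-monomialSum-filter p []       w with p w
  ... | true  = refl
  ... | false = refl
  coeff-monomialSum-filter p (v ∷ ws) w with List.≡-dec Fin._≟_ v w | p v in pv
  ... | yes refl | true  rewrite ≟w-refl v | coeff-monomialSum-filter p ws v | pv = refl
  ... | yes refl | false rewrite coeff-monomialSum-filter p ws v | pv = refl
  ... | no v≢w   | true  rewrite ≟w-≢ v≢w | coeff-monomialSum-filter p ws w with p w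
  ...   | true  = refl
  ...   | false = refl
  coeff-monomialSum-filter p (v ∷ ws) w | no v≢w | false rewrite coeff-monomialSum-filter p ws w with p w
  ...   | true  = sym (ℤ.+-identityˡ _)
  ...   | false = refl

  coeff-prefix-[] : ∀ i (z : U N) → coeff (generator i *U z) [] ≡ 0ℤ
  coeff-prefix-[] i []            = refl
  coeff-prefix-[] i ((b , v) ∷ z) = trans (ℤ.+-identityˡ _) (coeff-prefix-[] i z)

  coeff-prefix : ∀ i j (z : U N) w →
    coeff (generator i *U z) (j ∷ w) ≡ (if does (i Fin.≟ j) then coeff z w else 0ℤ)
  coeff-prefix i j []            w with i Fin.≟ j
  ... | yes _ = refl
  ... | no  _ = refl
  coeff-prefix i j ((b , v) ∷ z) w with i Fin.≟ j | coeff-prefix i j z w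
  ... | no  _    | ih = trans (ℤ.+-identityˡ _) ih
  ... | yes refl | ih with v ≟w w
  ...   | true  = cong₂ _+ℤ_ (ℤ.*-identityˡ b) ih
  ...   | false = cong (0ℤ +ℤ_) ih

  monomialSum-prefix : ∀ i ws → monomialSum (map (i ∷_) ws) ≡ generator i *U monomialSum ws
  monomialSum-prefix i []       = refl
  monomialSum-prefix i (v ∷ ws) = cong ((1ℤ , i ∷ v) ∷_) (monomialSum-prefix i ws)

  -- allWords (suc m) is definitionally extensions (allFin N) (allWords m).
  extensions : List (Fin N) → List (Word N) → List (Word N)
  extensions is ws = concatMap (λ i → map (i ∷_) ws) is

  coeff-extensions-[] : ∀ is ws → coeff (monomialSum (extensions is ws)) [] ≡ 0ℤ
  coeff-extensions-[] []       ws = refl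
  coeff-extensions-[] (i ∷ is) ws = begin
    coeff (monomialSum (map (i ∷_) ws ++ extensions is ws)) []
      ≡⟨ coeff-monomialSum-++ (map (i ∷_) ws) (extensions is ws) [] ⟩
    coeff (monomialSum (map (i ∷_) ws)) [] +ℤ coeff (monomialSum (extensions is ws)) []
      ≡⟨ cong₂ _+ℤ_ (trans (cong (λ z → coeff z []) (monomialSum-prefix i ws)) (coeff-prefix-[] i (monomialSum ws)))
                    (coeff-extensions-[] is ws) ⟩
    0ℤ ∎
    where open ≡-Reasoning

  coeff-extensions-∷ : ∀ i is ws j w → coeff (monomialSum (extensions (i ∷ is) ws)) (j ∷ w)
    ≡ (if does (i Fin.≟ j) then coeff (monomialSum ws) w else 0ℤ) +ℤ coeff (monomialSum (extensions is ws)) (j ∷ w)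
  coeff-extensions-∷ i is ws j w = trans (coeff-monomialSum-++ (map (i ∷_) ws) (extensions is ws) (j ∷ w))
    (cong (_+ℤ _) (trans (cong (λ z → coeff z (j ∷ w)) (monomialSum-prefix i ws)) (coeff-prefix i j (monomialSum ws) w)))

  coeff-extensions-∉ : ∀ {is} ws j w → All (_≢ j) is → coeff (monomialSum (extensions is ws)) (j ∷ w) ≡ 0ℤ
  coeff-extensions-∉ ws j w [] = refl
  coeff-extensions-∉ {i ∷ is} ws j w (i≢j ∷ is≢j) = begin
    coeff (monomialSum (extensions (i ∷ is) ws)) (j ∷ w)
      ≡⟨ coeff-extensions-∷ i is ws j w ⟩
    (if does (i Fin.≟ j) then coeff (monomialSum ws) w else 0ℤ) +ℤ coeff (monomialSum (extensions is ws)) (j ∷ w)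
      ≡⟨ cong₂ (λ b c → (if b then coeff (monomialSum ws) w else 0ℤ) +ℤ c)
               (dec-false (i Fin.≟ j) i≢j) (coeff-extensions-∉ ws j w is≢j) ⟩
    0ℤ ∎
    where open ≡-Reasoning

  coeff-extensions-∈ : ∀ {is} ws j w → Unique is → j ∈ is →
    coeff (monomialSum (extensions is ws)) (j ∷ w) ≡ coeff (monomialSum ws) w
  coeff-extensions-∈ {i ∷ is} ws j w (i∉is ∷ _) (here refl) = begin
    coeff (monomialSum (extensions (i ∷ is) ws)) (i ∷ w)
      ≡⟨ coeff-extensions-∷ i is ws i w ⟩
    (if does (i Fin.≟ i) then coeff (monomialSum ws) w else 0ℤ) +ℤ coeff (monomialSum (extensions is ws)) (i ∷ w)
      ≡⟨ cong₂ (λ b c → (if b then coeff (monomialSum ws) w else 0ℤ) +ℤ c)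
               (dec-true (i Fin.≟ i) refl) (coeff-extensions-∉ ws i w (All.map (λ i≢k k≡i → i≢k (sym k≡i)) i∉is)) ⟩
    coeff (monomialSum ws) w +ℤ 0ℤ
      ≡⟨ ℤ.+-identityʳ _ ⟩
    coeff (monomialSum ws) w ∎
    where open ≡-Reasoning
  coeff-extensions-∈ {i ∷ is} ws j w (i∉is ∷ unique) (there j∈is) = begin
    coeff (monomialSum (extensions (i ∷ is) ws)) (j ∷ w)
      ≡⟨ coeff-extensions-∷ i is ws j w ⟩
    (if does (i Fin.≟ j) then coeff (monomialSum ws) w else 0ℤ) +ℤ coeff (monomialSum (extensions is ws)) (j ∷ w)
      ≡⟨ cong₂ (λ b c → (if b then coeff (monomialSum ws) w else 0ℤ) +ℤ c)
               (dec-false (i Fin.≟ j) (All.lookup i∉is j∈is)) (coeff-extensions-∈ ws j w unique j∈is) ⟩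
    0ℤ +ℤ coeff (monomialSum ws) w
      ≡⟨ ℤ.+-identityˡ _ ⟩
    coeff (monomialSum ws) w ∎
    where open ≡-Reasoning

  coeff-allWords : ∀ m w → coeff (monomialSum (allWords m)) w ≡ indicator (length w ≡ᵇ m)
  coeff-allWords zero    []      = refl
  coeff-allWords zero    (j ∷ w) = refl
  coeff-allWords (suc m) []      = coeff-extensions-[] (allFin N) (allWords m)
  coeff-allWords (suc m) (j ∷ w) =
    trans (coeff-extensions-∈ (allWords m) j w (allFin⁺ N) (∈-allFin j)) (coeff-allWords m w)

  coeff-h : ∀ m w → coeff (h m) w ≡ indicator (nondecreasing w ∧ (length w ≡ᵇ m))
  coeff-h m w rewrite coeff-monomialSum-filter nondecreasing (allWords m) w | coeff-allWords m w with nondecreasing w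
  ... | true  = refl
  ... | false = refl

module Letters {N : ℕ} where
  open Monomials using (generator)

  -- Indices i ≥ N give the junk value 𝟘; only indices below N are ever used.
  letter : ℕ → U N
  letter i with i ℕ.<? N
  ... | yes i<N = generator (fromℕ< i<N)
  ... | no  _   = 𝟘

  letter-fromℕ< : ∀ {i} (i<N : i < N) → letter i ≡ generator (fromℕ< i<N)
  letter-fromℕ< {i} i<N with i ℕ.<? N
  ... | yes _   = refl
  ... | no  i≮N = contradiction i<N i≮N

  generatorsFrom : ℕ → ℕ → List (U N)
  generatorsFrom a zero    = []
  generatorsFrom a (suc k) = letter a ∷ generatorsFrom (suc a) k

  increasingFrom : ℕ → Word N → Bool
  increasingFrom a []      = true
  increasingFrom a (j ∷ w) = (a ≤ᵇ toℕ j) ∧ increasingFrom (toℕ j) w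

  nondecreasing-∷ : ∀ j w → nondecreasing (j ∷ w) ≡ increasingFrom (toℕ j) w
  nondecreasing-∷ j []       = refl
  nondecreasing-∷ j (k ∷ w)  = cong ((toℕ j ≤ᵇ toℕ k) ∧_) (nondecreasing-∷ k w)

  nondecreasing≡increasingFrom0 : ∀ w → nondecreasing w ≡ increasingFrom 0 w
  nondecreasing≡increasingFrom0 []      = refl
  nondecreasing≡increasingFrom0 (j ∷ w) = nondecreasing-∷ j w

  fromℕ<-mono-< : ∀ {i j} (i<N : i < N) (j<N : j < N) → i < j → fromℕ< i<N <ᶠ fromℕ< j<N
  fromℕ<-mono-< i<N j<N = subst₂ _<_ (sym (Fin.toℕ-fromℕ< i<N)) (sym (Fin.toℕ-fromℕ< j<N))

  All-generatorsFrom : ∀ {ℓ} {P : U N → Set ℓ} k b → k + b ≡ N → (∀ {i} → b ≤ i → i < N → P (letter i)) →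
                       All P (generatorsFrom b k)
  All-generatorsFrom zero    b _       _ = []
  All-generatorsFrom (suc k) b k+b≡N f =
    f ℕ.≤-refl (subst (b <_) k+b≡N (ℕ.m<n+m b (s≤s z≤n))) ∷
    All-generatorsFrom k (suc b) (trans (ℕ.+-suc k b) k+b≡N) (λ b<i → f (ℕ.<⇒≤ b<i))

  AllPairs-generatorsFrom : ∀ {ℓ} {R : U N → U N → Set ℓ} k b → k + b ≡ N →
                            (∀ {i j} → b ≤ i → i < j → j < N → R (letter i) (letter j)) →
                            AllPairs R (generatorsFrom b k)
  AllPairs-generatorsFrom zero    b _       _ = []
  AllPairs-generatorsFrom (suc k) b k+b≡N f =
    All-generatorsFrom k (suc b) k+sb≡N (f ℕ.≤-refl) ∷ AllPairs-generatorsFrom k (suc b) k+sb≡N (λ b<i → f (ℕ.<⇒≤ b<i))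
    where
    k+sb≡N : k + suc b ≡ N
    k+sb≡N = trans (ℕ.+-suc k b) k+b≡N

module Generated {N : ℕ} (I : U N → Set) (ideal : IsIdeal I) where
  open FreeRing
  open Monomials
  open Letters
  open Quotient I ideal
  open CompleteHomogeneous quotientRing

  coeff-complete-generatorsFrom : ∀ k a m → k + a ≡ N → ∀ w →
    coeff (complete (generatorsFrom a k) m) w ≡ indicator (increasingFrom a w ∧ (length w ≡ᵇ m))
  coeff-complete-generatorsFrom k       a zero    _ []      = refl
  coeff-complete-generatorsFrom k       a zero    _ (j ∷ w) = cong indicator (sym (∧-zeroʳ _))
  coeff-complete-generatorsFrom zero    a (suc m) _ []      = refl
  coeff-complete-generatorsFrom zero    a (suc m) refl (j ∷ w) =
    cong (λ b → indicator ((b ∧ increasingFrom (toℕ j) w) ∧ (length w ≡ᵇ m)))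
         (sym (dec-false (N ℕ.≤? toℕ j) (ℕ.<⇒≱ (Fin.toℕ<n j))))
  coeff-complete-generatorsFrom (suc k) a (suc m) k+a≡N w = begin
    coeff (letter a *U G +U G′) w
      ≡⟨ coeff-+U (letter a *U G) G′ w ⟩
    coeff (letter a *U G) w +ℤ coeff G′ w
      ≡⟨ cong₂ _+ℤ_ (cong (λ u → coeff (u *U G) w) (letter-fromℕ< a<N))
                    (coeff-complete-generatorsFrom k (suc a) (suc m) (trans (ℕ.+-suc k a) k+a≡N) w) ⟩
    coeff (generator (fromℕ< a<N) *U G) w +ℤ indicator (increasingFrom (suc a) w ∧ (length w ≡ᵇ suc m))
      ≡⟨ split w ⟩
    indicator (increasingFrom a w ∧ (length w ≡ᵇ suc m)) ∎
    where
    open ≡-Reasoning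
    a<N : a < N
    a<N = subst (a <_) k+a≡N (ℕ.m<n+m a (s≤s z≤n))
    G G′ : U N
    G  = complete (generatorsFrom a (suc k)) m
    G′ = complete (generatorsFrom (suc a) k) (suc m)
    split : ∀ w → coeff (generator (fromℕ< a<N) *U G) w +ℤ indicator (increasingFrom (suc a) w ∧ (length w ≡ᵇ suc m))
                  ≡ indicator (increasingFrom a w ∧ (length w ≡ᵇ suc m))
    split []      = cong (_+ℤ 0ℤ) (coeff-prefix-[] (fromℕ< a<N) G)
    split (j ∷ w) rewrite coeff-prefix (fromℕ< a<N) j G w with fromℕ< a<N Fin.≟ j
    ... | yes refl rewrite Fin.toℕ-fromℕ< a<N | dec-false (suc a ℕ.≤? a) (ℕ.n≮n a) | dec-true (a ℕ.≤? a) ℕ.≤-refl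
                         | coeff-complete-generatorsFrom (suc k) a m k+a≡N w = ℤ.+-identityʳ _
    ... | no  a≢j  rewrite ≤ᵇ-suc (λ j≡a → a≢j (Fin.toℕ-injective (trans (Fin.toℕ-fromℕ< a<N) (sym j≡a)))) = ℤ.+-identityˡ _

  generators : List (U N)
  generators = generatorsFrom 0 N

  h≈complete : ∀ m → h m ≈ complete generators m
  h≈complete m w = begin
    coeff (h m) w
      ≡⟨ coeff-h m w ⟩
    indicator (nondecreasing w ∧ (length w ≡ᵇ m))
      ≡⟨ cong (λ b → indicator (b ∧ (length w ≡ᵇ m))) (nondecreasing≡increasingFrom0 w) ⟩
    indicator (increasingFrom 0 w ∧ (length w ≡ᵇ m))
      ≡⟨ coeff-complete-generatorsFrom N 0 m (ℕ.+-identityʳ N) w ⟨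
    coeff (complete generators m) w
      ∎
    where open ≡-Reasoning

  module _ (IC⊆I : ∀ x → IC x → I x) where

    generator~0 : ∀ {x} → GenC x → x ~ 𝟘
    generator~0 {x} g = quot (subst I (sym (List.++-identityʳ x)) (IC⊆I x (gen g)))

    generators-absorb : ∀ {i j} → i <ᶠ j →
                        generator j *U [ generator j , generator i ] ~ [ generator j , generator i ] *U generator i
    generators-absorb {i} {j} i<j =
      intertwining-from-generator (generator j) (generator j) (generator i) (generator i) (generator~0 (g1 i j i<j))

    generators-commute : ∀ {i j k} → i <ᶠ j → j <ᶠ k →
                         generator j *U [ generator k , generator i ] ~ [ generator k , generator i ] *U generator j
    generators-commute {i} {j} {k} i<j j<k =
      intertwining-from-generator (generator j) (generator k) (generator i) (generator j) (generator~0 (g2 i j k i<j j<k))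

    generators-annihilate : ∀ {i j k} → i <ᶠ j → j <ᶠ k →
                            [ generator k , generator j ] *U [ generator k , generator i ] ~ 𝟘
    generators-annihilate {i} {j} {k} i<j j<k =
      annihilation-from-generator (generator i) (generator j) (generator k) (generator~0 (g3 i j k i<j j<k))

    letters-absorb : ∀ {a b} → a < b → b < N → letter b *U [ letter b , letter a ] ~ [ letter b , letter a ] *U letter a
    letters-absorb {a} {b} a<b b<N with a<N ← ℕ.<-trans a<b b<N rewrite letter-fromℕ< a<N | letter-fromℕ< b<N =
      generators-absorb (fromℕ<-mono-< a<N b<N a<b)

    letters-commute : ∀ {a b c} → a < b → b < c → c < N →
                      letter b *U [ letter c , letter a ] ~ [ letter c , letter a ] *U letter b
    letters-commute {a} {b} {c} a<b b<c c<N with b<N ← ℕ.<-trans b<c c<N with a<N ← ℕ.<-trans a<b b<N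
      rewrite letter-fromℕ< a<N | letter-fromℕ< b<N | letter-fromℕ< c<N =
      generators-commute (fromℕ<-mono-< a<N b<N a<b) (fromℕ<-mono-< b<N c<N b<c)

    letters-annihilate : ∀ {a b c} → a < b → b < c → c < N →
                         [ letter c , letter b ] *U [ letter c , letter a ] ~ 𝟘
    letters-annihilate {a} {b} {c} a<b b<c c<N with b<N ← ℕ.<-trans b<c c<N with a<N ← ℕ.<-trans a<b b<N
      rewrite letter-fromℕ< a<N | letter-fromℕ< b<N | letter-fromℕ< c<N =
      generators-annihilate (fromℕ<-mono-< a<N b<N a<b) (fromℕ<-mono-< b<N c<N b<c)

    generatorsFrom-relations : ∀ k a → k + a ≡ N → Relations (generatorsFrom a k)
    generatorsFrom-relations zero    a _       = []
    generatorsFrom-relations (suc k) a k+a≡N = lowest ∷ generatorsFrom-relations k (suc a) k+sa≡N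
      where
      k+sa≡N : k + suc a ≡ N
      k+sa≡N = trans (ℕ.+-suc k a) k+a≡N
      lowest : LowestRelations (letter a) (generatorsFrom (suc a) k)
      lowest = record
        { absorb     = All-generatorsFrom k (suc a) k+sa≡N letters-absorb
        ; commute    = AllPairs-generatorsFrom k (suc a) k+sa≡N (λ a<i → letters-commute a<i)
        ; annihilate = AllPairs-generatorsFrom k (suc a) k+sa≡N (λ a<i → letters-annihilate a<i)
        }

    generators-relations : Relations generators
    generators-relations = generatorsFrom-relations N 0 (ℕ.+-identityʳ N)

module SeriesProducts {N : ℕ} where
  open FreeRing

  sumU-applyUpTo-𝟘 : ∀ n (f : ℕ → U N) → (∀ j → j < n → f j ≡ 𝟘) → sumU (applyUpTo f n) ≡ 𝟘
  sumU-applyUpTo-𝟘 zero    f _ = refl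
  sumU-applyUpTo-𝟘 (suc n) f f≡𝟘 =
    cong₂ _++_ (f≡𝟘 0 (s≤s z≤n)) (sumU-applyUpTo-𝟘 n (f ∘ suc) (λ j j<n → f≡𝟘 (suc j) (s≤s j<n)))

  sumU-applyUpTo-head : ∀ n (f : ℕ → U N) → (∀ j → j < n → f (suc j) ≡ 𝟘) → sumU (applyUpTo f (suc n)) ≡ f 0
  sumU-applyUpTo-head n f f≡𝟘 = trans (cong (f 0 ++_) (sumU-applyUpTo-𝟘 n (f ∘ suc) f≡𝟘)) (List.++-identityʳ (f 0))

  sumU-applyUpTo-last : ∀ n (f : ℕ → U N) → (∀ j → j < n → f j ≡ 𝟘) → sumU (applyUpTo f (suc n)) ≡ f n
  sumU-applyUpTo-last zero    f _   = List.++-identityʳ (f 0)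
  sumU-applyUpTo-last (suc n) f f≡𝟘 =
    cong₂ _++_ (f≡𝟘 0 (s≤s z≤n)) (sumU-applyUpTo-last n (f ∘ suc) (λ j j<n → f≡𝟘 (suc j) (s≤s j<n)))

  *S-rows : ∀ (F G : Series) k l →
    (F *S G) k l ≡ sumU (applyUpTo (λ i → sumU (map (λ j → F i j *U G (k ∸ i) (l ∸ j)) (upTo (suc l)))) (suc k))
  *S-rows F G k l = begin
    concat (concat (map row (upTo (suc k))))      ≡⟨ List.concat-concat (map row (upTo (suc k))) ⟨
    concat (map concat (map row (upTo (suc k))))  ≡⟨ cong concat (List.map-∘ (upTo (suc k))) ⟨
    concat (map (concat ∘ row) (upTo (suc k)))    ≡⟨ cong concat (List.map-upTo (concat ∘ row) (suc k)) ⟩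
    concat (applyUpTo (concat ∘ row) (suc k))     ∎
    where
    open ≡-Reasoning
    row : ℕ → List (U N)
    row i = map (λ j → F i j *U G (k ∸ i) (l ∸ j)) (upTo (suc l))

  ∸-suc : ∀ {i k} → i < k → k ∸ i ≡ suc (k ∸ suc i)
  ∸-suc i<k = ℕ.+-∸-assoc 1 i<k

  *S-xy : ∀ {F G : Series} → (∀ i j → F i (suc j) ≡ 𝟘) → (∀ i j → G (suc i) j ≡ 𝟘) →
          ∀ k l → (F *S G) k l ≡ F k 0 *U G 0 l
  *S-xy {F} {G} F-in-x G-in-y k l = begin
    (F *S G) k l                                   ≡⟨ *S-rows F G k l ⟩
    sumU (applyUpTo row (suc k))                   ≡⟨ sumU-applyUpTo-last k row row-vanishes ⟩
    sumU (map (term k) (upTo (suc l)))             ≡⟨ cong sumU (List.map-upTo (term k) (suc l)) ⟩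
    sumU (applyUpTo (term k) (suc l))              ≡⟨ sumU-applyUpTo-head l (term k) (λ j _ → cong (_*U _) (F-in-x k j)) ⟩
    F k 0 *U G (k ∸ k) l                           ≡⟨ cong (λ n → F k 0 *U G n l) (ℕ.n∸n≡0 k) ⟩
    F k 0 *U G 0 l                                 ∎
    where
    open ≡-Reasoning
    term : ℕ → ℕ → U N
    term i j = F i j *U G (k ∸ i) (l ∸ j)
    row : ℕ → U N
    row i = sumU (map (term i) (upTo (suc l)))
    row-vanishes : ∀ i → i < k → row i ≡ 𝟘
    row-vanishes i i<k = trans (cong sumU (List.map-upTo (term i) (suc l)))
                               (sumU-applyUpTo-𝟘 (suc l) (term i) (λ j _ → begin
      F i j *U G (k ∸ i) (l ∸ j)               ≡⟨ cong (λ n → F i j *U G n (l ∸ j)) (∸-suc i<k) ⟩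
      F i j *U G (suc (k ∸ suc i)) (l ∸ j)     ≡⟨ cong (F i j *U_) (G-in-y _ _) ⟩
      F i j *U 𝟘                               ≡⟨ *U-zeroʳ (F i j) ⟩
      𝟘                                        ∎))

  *S-yx : ∀ {G F : Series} → (∀ i j → G (suc i) j ≡ 𝟘) → (∀ i j → F i (suc j) ≡ 𝟘) →
          ∀ k l → (G *S F) k l ≡ G 0 l *U F k 0
  *S-yx {G} {F} G-in-y F-in-x k l = begin
    (G *S F) k l                                   ≡⟨ *S-rows G F k l ⟩
    sumU (applyUpTo row (suc k))                   ≡⟨ sumU-applyUpTo-head k row row-vanishes ⟩
    sumU (map (term 0) (upTo (suc l)))             ≡⟨ cong sumU (List.map-upTo (term 0) (suc l)) ⟩
    sumU (applyUpTo (term 0) (suc l))              ≡⟨ sumU-applyUpTo-last l (term 0) term-vanishes ⟩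
    G 0 l *U F k (l ∸ l)                           ≡⟨ cong (λ n → G 0 l *U F k n) (ℕ.n∸n≡0 l) ⟩
    G 0 l *U F k 0                                 ∎
    where
    open ≡-Reasoning
    term : ℕ → ℕ → U N
    term i j = G i j *U F (k ∸ i) (l ∸ j)
    row : ℕ → U N
    row i = sumU (map (term i) (upTo (suc l)))
    row-vanishes : ∀ i → i < k → row (suc i) ≡ 𝟘
    row-vanishes i _ = trans (cong sumU (List.map-upTo (term (suc i)) (suc l)))
      (sumU-applyUpTo-𝟘 (suc l) (term (suc i)) (λ j _ → cong (_*U F (k ∸ suc i) (l ∸ j)) (G-in-y i j)))
    term-vanishes : ∀ j → j < l → term 0 j ≡ 𝟘
    term-vanishes j j<l = begin
      G 0 j *U F k (l ∸ j)              ≡⟨ cong (λ n → G 0 j *U F k n) (∸-suc j<l) ⟩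
      G 0 j *U F k (suc (l ∸ suc j))    ≡⟨ cong (G 0 j *U_) (F-in-x k _) ⟩
      G 0 j *U 𝟘                        ≡⟨ *U-zeroʳ (G 0 j) ⟩
      𝟘                                 ∎

module Commutation {N : ℕ} (I : U N → Set) (ideal : IsIdeal I) (IC⊆I : ∀ x → IC x → I x) where
  open Quotient I ideal
  open Ring quotientRing using (setoid; *-cong)
  open CompleteHomogeneous quotientRing using (complete; complete-commute)
  open Generated I ideal
  open SeriesProducts
  open FreeRing using (≡⇒≈)
  open import Relation.Binary.Reasoning.Setoid setoid

  h~complete : ∀ m → h m ~ complete generators m
  h~complete m = ≈⇒~ (h≈complete m)

  h-commute : ∀ k l → h k *U h l ~ h l *U h k
  h-commute k l = begin
    h k *U h l                                        ≈⟨ *-cong (h~complete k) (h~complete l) ⟩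
    complete generators k *U complete generators l    ≈⟨ complete-commute (generators-relations IC⊆I) k l ⟩
    complete generators l *U complete generators k    ≈⟨ *-cong (h~complete l) (h~complete k) ⟨
    h l *U h k                                        ∎

  HxHy~HyHx : ∀ k l → (Hx *S Hy) k l ~ (Hy *S Hx) k l
  HxHy~HyHx k l = begin
    (Hx *S Hy) k l   ≡⟨ *S-xy {F = Hx} {G = Hy} (λ _ _ → refl) (λ _ _ → refl) k l ⟩
    h k *U h l       ≈⟨ h-commute k l ⟩
    h l *U h k       ≡⟨ *S-yx {G = Hy} {F = Hx} (λ _ _ → refl) (λ _ _ → refl) k l ⟨
    (Hy *S Hx) k l   ∎

corollary2p4 : (N : ℕ) (I : U N → Set) → IsIdeal I → (∀ x → IC x → I x) →
    ((k l : ℕ) → k ≥ 1 → l ≥ 1 → I (h k *U h l -U h l *U h k))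
    × (Hx *S Hy) ≡S (Hy *S Hx) mod I
corollary2p4 N I ideal IC⊆I =
  (λ k l _ _ → difference∈ (h-commute k l)) , (λ k l → difference∈ (HxHy~HyHx k l))
  where
  open Quotient I ideal using (difference∈)
  open Commutation I ideal IC⊆I
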